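{- Let $N$ be a polygonal norm in the plane $\mathbb{R}^2$, and let $\lambda$ be the smallest $N$-distance between two consecutive vertices of its unit disc. Then for each positive $q < \lambda/(1+\lambda)$, we have $\chi\big(\mathbb{R}^2, N, \mathcal{G}(q)\big) \ge 3$. In other words, for every two-colouring of the plane, there exists a monochromatic $N$-isometric copy of $\mathcal{G}(q)$.
   Context: A norm $N$ on $\mathbb{R}^2$ is denoted $\|\cdot\|_N$; the $N$-distance between $\mathbf{x}, \mathbf{y}$ is $\|\mathbf{x}-\mathbf{y}\|_N$. The norm $N$ is polygonal if its unit disc $\{\mathbf{x} \in \mathbb{R}^2 : \|\mathbf{x}\|_N \le 1\}$ is a (convex) polygon. For $q>0$, $\mathcal{G}(q) = \{0,\, 1,\, 1+q,\, 1+q+q^2,\, \dots\} \subset \mathbb{R}$ is the infinite geometric progression, regarded as a metric space with distance $|x-y|$. A set $\mathcal{M}' \subset \mathbb{R}^2$ is an $N$-isometric copy of $\mathcal{G}(q)$ if there exists a bijection $f : \mathcal{G}(q) \to \mathcal{M}'$ such that $\|f(x)-f(y)\|_N = |x-y|$ for all $x, y \in \mathcal{G}(q)$ (copies need not be collinear). The chromatic number $\chi(\mathbb{R}^2, N, \mathcal{G}(q))$ is the minimum number of colours needed to colour all points of $\mathbb{R}^2$ such that no $N$-isometric copy of $\mathcal{G}(q)$ is monochromatic. -}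

module Defs where

open import Algebra.Bundles using (CommutativeRing)
open import Algebra.Module.Bundles using (Module)
import Algebra.Construct.NaturalChoice.Max as Max
import Algebra.Module.Construct.DirectProduct as DirectProduct
import Algebra.Module.Construct.TensorUnit as TensorUnit
import Algebra.Properties.CommutativeMonoid.Sum as Sum
import Algebra.Properties.Semiring.Exp as Exp
open import Data.Fin.Base using (Fin; toℕ)
open import Data.Nat.Base as ℕ using (ℕ; zero; suc)
open import Data.Nat.DivMod using (_mod_)
open import Data.Product.Base using (Σ; ∃; ∃-syntax; Σ-syntax; _×_; _,_; proj₁; proj₂)
open import Function.Bundles using (Bijection; Func)
open import Level using (0ℓ) renaming (suc to lsuc)
open import Relation.Binary.Bundles using (Setoid; TotalOrder)
open import Relation.Binary.Core using (Rel)
open import Relation.Binary.Structures using (IsTotalOrder)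
import Relation.Binary.Construct.NonStrictToStrict as NonStrictToStrict
import Relation.Binary.Construct.On as On
open import Relation.Binary.PropositionalEquality using (_≡_; _≢_)
import Relation.Binary.PropositionalEquality.Properties as ≡
open import Relation.Nullary using (¬_)
open import Relation.Unary using (Pred; _∈_; _≐_)

-- The real numbers are axiomatised as a (Dedekind-)complete ordered field,
-- which determines them up to isomorphism.  Equality is the setoid equality _≈_.
record CompleteOrderedField : Set (lsuc 0ℓ) where
  field
    commutativeRing : CommutativeRing 0ℓ 0ℓ

  open CommutativeRing commutativeRing public

  infix 4 _≤_
  infix 8 _⁻¹

  field
    _≤_          : Rel Carrier 0ℓ
    isTotalOrder : IsTotalOrder _≈_ _≤_
    +-monoʳ-≤    : ∀ x {y z} → y ≤ z → x + y ≤ x + z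
    *-nonNeg     : ∀ {x y} → 0# ≤ x → 0# ≤ y → 0# ≤ x * y
    0≉1          : ¬ (0# ≈ 1#)
    -- Total, as usual in a classical setting; 0# ⁻¹ is left unspecified.
    _⁻¹          : Carrier → Carrier
    ⁻¹-cong      : ∀ {x y} → x ≈ y → x ⁻¹ ≈ y ⁻¹
    *-inverseʳ   : ∀ {x} → ¬ (x ≈ 0#) → x * x ⁻¹ ≈ 1#

  IsUpperBound : Pred Carrier 0ℓ → Carrier → Set
  IsUpperBound S b = ∀ x → x ∈ S → x ≤ b

  field
    supremum : (S : Pred Carrier 0ℓ) → ∃ S → ∃ (IsUpperBound S) →
               ∃[ s ] (IsUpperBound S s × (∀ b → IsUpperBound S b → s ≤ b))

  totalOrder : TotalOrder 0ℓ 0ℓ 0ℓ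
  totalOrder = record { isTotalOrder = isTotalOrder }

  open NonStrictToStrict _≈_ _≤_ public using (_<_)
  open Max totalOrder public using (_⊔_)
  open Exp semiring public using (_^_)

  infixl 7 _/_
  _/_ : Carrier → Carrier → Carrier
  x / y = x * y ⁻¹

  ∣_∣ : Carrier → Carrier
  ∣ x ∣ = x ⊔ (- x)

module Plane (R : CompleteOrderedField) where

  open CompleteOrderedField R public
    renaming (Carrier to ℝ; setoid to ℝ-setoid)

  ℝ²-module : Module commutativeRing 0ℓ 0ℓ
  ℝ²-module = DirectProduct.⟨module⟩ TensorUnit.⟨module⟩ TensorUnit.⟨module⟩

  open Module ℝ²-module public
    using (_≈ᴹ_; _+ᴹ_; -ᴹ_; _*ₗ_; 0ᴹ; +ᴹ-commutativeMonoid; ≈ᴹ-setoid)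
    renaming (Carrierᴹ to ℝ²)

  infixl 6 _-ᴹ_
  _-ᴹ_ : ℝ² → ℝ² → ℝ²
  x -ᴹ y = x +ᴹ (-ᴹ y)

  record Norm : Set where
    field
      ∥_∥         : ℝ² → ℝ
      ∥∥-cong     : ∀ {x y} → x ≈ᴹ y → ∥ x ∥ ≈ ∥ y ∥
      nonNegative : ∀ x → 0# ≤ ∥ x ∥
      definite    : ∀ x → ∥ x ∥ ≈ 0# → x ≈ᴹ 0ᴹ
      homogeneous : ∀ a x → ∥ a *ₗ x ∥ ≈ ∣ a ∣ * ∥ x ∥
      triangle    : ∀ x y → ∥ x +ᴹ y ∥ ≤ ∥ x ∥ + ∥ y ∥

    dist : ℝ² → ℝ² → ℝ
    dist x y = ∥ x -ᴹ y ∥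

    unitDisc : Pred ℝ² 0ℓ
    unitDisc x = ∥ x ∥ ≤ 1#

  next : ∀ {n} → Fin (suc n) → Fin (suc n)
  next {n} i = suc (toℕ i) mod suc n

  -- Twice the signed area of the triangle a b c; positive iff c lies strictly
  -- to the left of the directed line from a to b.
  orient : ℝ² → ℝ² → ℝ² → ℝ
  orient (a₁ , a₂) (b₁ , b₂) (c₁ , c₂) =
    (b₁ - a₁) * (c₂ - a₂) - (b₂ - a₂) * (c₁ - a₁)

  -- A convex polygon is given by its vertices in counterclockwise cyclic order.
  -- Strict convexity at every side excludes repeated and redundant vertices as
  -- well as self-intersecting (star-shaped) orders, so vertex i and
  -- vertex (next i) are exactly the pairs of consecutive vertices.
  record ConvexPolygon : Set where
    field
      extra  : ℕ

    size : ℕ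
    size = 3 ℕ.+ extra

    field
      vertex : Fin size → ℝ²
      convex : ∀ i j → j ≢ i → j ≢ next i →
               0# < orient (vertex i) (vertex (next i)) (vertex j)

    region : Pred ℝ² 0ℓ
    region x = Σ[ w ∈ (Fin size → ℝ) ]
      (∀ i → 0# ≤ w i) ×
      Sum.sum +-commutativeMonoid w ≈ 1# ×
      Sum.sum +ᴹ-commutativeMonoid (λ i → w i *ₗ vertex i) ≈ᴹ x

  record Polygonal (N : Norm) : Set where
    open Norm N
    field
      polygon          : ConvexPolygon
      unitDisc≐polygon : unitDisc ≐ ConvexPolygon.region polygon

    open ConvexPolygon polygon public

    sideLength : Fin size → ℝ
    sideLength i = dist (vertex i) (vertex (next i))

    IsSmallestSideLength : ℝ → Set
    IsSmallestSideLength s = (∀ i → s ≤ sideLength i) × (∃[ i ] s ≈ sideLength i)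

  partialSum : ℝ → ℕ → ℝ
  partialSum q zero    = 0#
  partialSum q (suc n) = partialSum q n + q ^ n

  𝒢 : ℝ → Pred ℝ 0ℓ
  𝒢 q x = ∃[ n ] x ≈ partialSum q n

  subsetSetoid : (S : Setoid 0ℓ 0ℓ) → Pred (Setoid.Carrier S) 0ℓ → Setoid 0ℓ 0ℓ
  subsetSetoid S P = On.setoid {B = Σ (Setoid.Carrier S) P} S proj₁

  IsIsometricCopy : Norm → Pred ℝ 0ℓ → Pred ℝ² 0ℓ → Set
  IsIsometricCopy N M M′ =
    Σ[ f ∈ Bijection (subsetSetoid ℝ-setoid M) (subsetSetoid ≈ᴹ-setoid M′) ]
      (∀ x y → Norm.dist N (proj₁ (Bijection.to f x)) (proj₁ (Bijection.to f y))
               ≈ ∣ proj₁ x - proj₁ y ∣)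

  -- Colourings respect the equality of points.
  Colouring : ℕ → Set
  Colouring k = Func ≈ᴹ-setoid (≡.setoid (Fin k))

  IsMonochromatic : ∀ {k} → Colouring k → Pred ℝ² 0ℓ → Set
  IsMonochromatic {k} c S = Σ[ a ∈ Fin k ] (∀ p → p ∈ S → Func.to c p ≡ a)

  HasMonochromaticCopy : Norm → Pred ℝ 0ℓ → ∀ {k} → Colouring k → Set (lsuc 0ℓ)
  HasMonochromaticCopy N M c =
    Σ[ M′ ∈ Pred ℝ² 0ℓ ] IsIsometricCopy N M M′ × IsMonochromatic c M′

  Colourable : Norm → Pred ℝ 0ℓ → ℕ → Set (lsuc 0ℓ)
  Colourable N M k = Σ[ c ∈ Colouring k ] ¬ HasMonochromaticCopy N M c

  -- χ(ℝ², N, M) ≥ m.  The chromatic number is the least k with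
  -- Colourable N M k, and infinite when there is none.
  χ[_,_]≥_ : Norm → Pred ℝ 0ℓ → ℕ → Set (lsuc 0ℓ)
  χ[ N , M ]≥ m = ∀ k → Colourable N M k → m ℕ.≤ k

module Submission where

open import Defs
open import Algebra.Bundles using (CommutativeRing)
import Algebra.Properties.CommutativeMonoid.Sum as Sum
open import Algebra.Solver.Ring.AlmostCommutativeRing using (fromCommutativeRing; _-Raw-AlmostCommutative⟶_)
open import Axiom.ExcludedMiddle using (ExcludedMiddle)
open import Data.Empty using (⊥; ⊥-elim)
open import Data.Fin.Base using (Fin; zero; suc; toℕ; opposite; inject≤)
import Data.Fin.Properties as Fin
open import Data.Integer.Base as ℤ using (ℤ; +_; -[1+_])
import Data.Integer.Properties as ℤ
import Data.Maybe.Base as Maybe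
open import Data.Nat.Base as ℕ using (ℕ; zero; suc)
import Data.Nat.DivMod as ℕ
open import Data.Nat.GeneralisedArithmetic using (fold; fold-+)
open import Data.Nat.Induction using (<-rec)
import Data.Nat.Properties as ℕ
open import Data.Product using (Σ-syntax; ∃; ∃-syntax; _×_; _,_; proj₁; proj₂)
open import Data.Sum.Base using (_⊎_; inj₁; inj₂)
open import Function.Base using (_∘_)
open import Function.Bundles using (Func)
open import Level using (0ℓ)
open import Relation.Binary.Bundles using (TotalOrder)
import Relation.Binary.PropositionalEquality as ≡
open ≡ using (_≡_; _≢_)
open import Relation.Nullary using (¬_; contradiction; yes; no)
open import Relation.Nullary.Decidable using (dec⇒maybe)
open import Relation.Unary using (_∈_)

-- Call a translate of q^n times a side of the unit disc uniform of level n if it is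
-- monochromatic.  The norm is additive on the cone over a side, so a sequence whose n-th
-- step lies in q^n times a fixed side is a copy of the progression.  If such a sequence
-- cannot be chosen greedily in one colour, then a uniform translate exists; take one of
-- minimal level n.  The hypothesis says q/(1 - q) < λ, so it contains, along its direction,
-- the terms of a copy with index > n, with room to spare.  By minimality of n a choice of
-- the term of index n in the same colour could be extended down to index 0.  Hence all
-- candidates for it, a translate of another side, have the opposite colour, and this holds
-- for every position of the tail.  Iterating, the sides visited recur, and at every visit
-- of a recurrent side its monochromatic translates along its own direction fill a strip
-- that has grown by a fixed amount, until the strip accommodates the missing term itself.

-- A ring solver with integer coefficients.

module IntegerSolver (R : CommutativeRing 0ℓ 0ℓ) where

  open CommutativeRing R
  open import Algebra.Properties.Ring ring
  open import Algebra.Properties.AbelianGroup +-abelianGroup using (⁻¹-∙-comm; ⁻¹-involutive; ε⁻¹≈ε)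
  open import Algebra.Properties.CommutativeSemigroup +-commutativeSemigroup using (interchange)
  open import Algebra.Properties.Semiring.Mult.TCOptimised semiring
    using (×-homo-+; ×1-homo-*; 1+×) renaming (_×_ to _·_)
  open import Relation.Binary.Reasoning.Setoid setoid

  -- With the optimised multiple, `+ 0` and `+ 1` evaluate to `0#` and `1#` by computation, so
  -- constants in solved identities match those in the goals.
  ⟦_⟧ℤ : ℤ → Carrier
  ⟦ + n ⟧ℤ      = n · 1#
  ⟦ -[1+ n ] ⟧ℤ = - (ℕ.suc n · 1#)

  neg-homo : ∀ i → ⟦ ℤ.- i ⟧ℤ ≈ - ⟦ i ⟧ℤ
  neg-homo (+ zero)  = sym ε⁻¹≈ε
  neg-homo (+ suc n) = refl
  neg-homo -[1+ n ]  = sym (⁻¹-involutive _)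

  ⊖-homo : ∀ m n → ⟦ m ℤ.⊖ n ⟧ℤ ≈ m · 1# - n · 1#
  ⊖-homo m       zero    = begin
    ⟦ m ℤ.⊖ 0 ⟧ℤ   ≡⟨⟩
    m · 1#          ≈⟨ +-identityʳ _ ⟨
    m · 1# + 0#     ≈⟨ +-congˡ ε⁻¹≈ε ⟨
    m · 1# - 0#     ∎
  ⊖-homo zero    (suc n) = sym (+-identityˡ _)
  ⊖-homo (suc m) (suc n) = begin
    ⟦ suc m ℤ.⊖ suc n ⟧ℤ                      ≡⟨ ≡.cong ⟦_⟧ℤ (ℤ.[1+m]⊖[1+n]≡m⊖n m n) ⟩
    ⟦ m ℤ.⊖ n ⟧ℤ                              ≈⟨ ⊖-homo m n ⟩
    m · 1# - n · 1#                           ≈⟨ +-identityˡ _ ⟨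
    0# + (m · 1# - n · 1#)                    ≈⟨ +-congʳ (-‿inverseʳ 1#) ⟨
    (1# - 1#) + (m · 1# - n · 1#)             ≈⟨ interchange _ _ _ _ ⟩
    (1# + m · 1#) + (- 1# - n · 1#)           ≈⟨ +-congˡ (⁻¹-∙-comm _ _) ⟩
    (1# + m · 1#) - (1# + n · 1#)             ≈⟨ +-cong (1+× m 1#) (-‿cong (1+× n 1#)) ⟨
    suc m · 1# - suc n · 1#                   ∎

  +-homo : ∀ i j → ⟦ i ℤ.+ j ⟧ℤ ≈ ⟦ i ⟧ℤ + ⟦ j ⟧ℤ
  +-homo (+ m)    (+ n)    = ×-homo-+ 1# m n
  +-homo (+ m)    -[1+ n ] = ⊖-homo m (suc n)
  +-homo -[1+ m ] (+ n)    = trans (⊖-homo n (suc m)) (+-comm _ _)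
  +-homo -[1+ m ] -[1+ n ] = begin
    - (suc (suc (m ℕ.+ n)) · 1#)     ≡⟨ ≡.cong (λ k → - (k · 1#)) (ℕ.+-suc (suc m) n) ⟨
    - ((suc m ℕ.+ suc n) · 1#)       ≈⟨ -‿cong (×-homo-+ 1# (suc m) (suc n)) ⟩
    - (suc m · 1# + suc n · 1#)      ≈⟨ ⁻¹-∙-comm _ _ ⟨
    - (suc m · 1#) - suc n · 1#      ∎

  +*+-homo : ∀ m n → ⟦ + m ℤ.* + n ⟧ℤ ≈ m · 1# * n · 1#
  +*+-homo m n = trans (reflexive (≡.cong ⟦_⟧ℤ (≡.sym (ℤ.pos-* m n)))) (×1-homo-* m n)

  *+-homo : ∀ i n → ⟦ i ℤ.* + n ⟧ℤ ≈ ⟦ i ⟧ℤ * n · 1#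
  *+-homo (+ m)    n = +*+-homo m n
  *+-homo -[1+ m ] n = begin
    ⟦ -[1+ m ] ℤ.* + n ⟧ℤ       ≡⟨ ≡.cong ⟦_⟧ℤ (ℤ.neg-distribˡ-* (+ suc m) (+ n)) ⟨
    ⟦ ℤ.- (+ suc m ℤ.* + n) ⟧ℤ  ≈⟨ neg-homo (+ suc m ℤ.* + n) ⟩
    - ⟦ + suc m ℤ.* + n ⟧ℤ      ≈⟨ -‿cong (+*+-homo (suc m) n) ⟩
    - (suc m · 1# * n · 1#)      ≈⟨ -‿distribˡ-* _ _ ⟩
    - (suc m · 1#) * n · 1#      ∎

  *-homo : ∀ i j → ⟦ i ℤ.* j ⟧ℤ ≈ ⟦ i ⟧ℤ * ⟦ j ⟧ℤ
  *-homo i (+ n)    = *+-homo i n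
  *-homo i -[1+ n ] = begin
    ⟦ i ℤ.* -[1+ n ] ⟧ℤ         ≡⟨ ≡.cong ⟦_⟧ℤ (ℤ.neg-distribʳ-* i (+ suc n)) ⟨
    ⟦ ℤ.- (i ℤ.* + suc n) ⟧ℤ    ≈⟨ neg-homo (i ℤ.* + suc n) ⟩
    - ⟦ i ℤ.* + suc n ⟧ℤ        ≈⟨ -‿cong (*+-homo i (suc n)) ⟩
    - (⟦ i ⟧ℤ * suc n · 1#)      ≈⟨ -‿distribʳ-* _ _ ⟩
    ⟦ i ⟧ℤ * - (suc n · 1#)      ∎

  morphism : ℤ.+-*-rawRing -Raw-AlmostCommutative⟶ fromCommutativeRing R
  morphism = record
    { ⟦_⟧    = ⟦_⟧ℤ
    ; +-homo = +-homo
    ; *-homo = *-homo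
    ; -‿homo = neg-homo
    ; 0-homo = refl
    ; 1-homo = refl
    }

  open import Algebra.Solver.Ring ℤ.+-*-rawRing (fromCommutativeRing R) morphism
    (λ i j → Maybe.map (λ i≡j → reflexive (≡.cong ⟦_⟧ℤ i≡j)) (dec⇒maybe (i ℤ.≟ j)))
    public using (solve; con; _:=_; _:+_; _:*_; _:-_; :-_)

-- Arithmetic in an ordered field.

module OrderedField (R : CompleteOrderedField) where

  open Plane R hiding (zero)
  open IntegerSolver commutativeRing
  open TotalOrder totalOrder public using (≤-respˡ-≈; ≤-respʳ-≈)
    renaming (refl to ≤-refl; reflexive to ≤-reflexive; trans to ≤-trans; antisym to ≤-antisym; total to ≤-total)
  open import Algebra.Construct.NaturalChoice.Max totalOrder using (⊔-cong; ⊔-comm; x≤y⇒x⊔y≈y; x≤y⇒y⊔x≈y)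

  -- If l − r = k (x − y) is a ring identity, then x ≈ y gives l ≈ r.
  ≈-from : ∀ {x y l r} k → x ≈ y → l + k * y ≈ r + k * x → l ≈ r
  ≈-from {x} {y} {l} {r} k x≈y eq = begin
    l                    ≈⟨ solve 2 (λ l ky → l := l :+ ky :- ky) refl l (k * y) ⟩
    l + k * y - k * y    ≈⟨ +-congʳ (trans eq (+-congˡ (*-congˡ x≈y))) ⟩
    r + k * y - k * y    ≈⟨ solve 2 (λ r ky → r :+ ky :- ky := r) refl r (k * y) ⟩
    r                    ∎
    where open import Relation.Binary.Reasoning.Setoid ℝ-setoid

  ≤-from : ∀ {x y p} → 0# ≤ p → y ≈ x + p → x ≤ y
  ≤-from {x} 0≤p y≈x+p = ≤-respʳ-≈ (sym y≈x+p) (≤-respˡ-≈ (+-identityʳ x) (+-monoʳ-≤ x 0≤p))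

  0≤-cong : ∀ {x y} → x ≈ y → 0# ≤ x → 0# ≤ y
  0≤-cong = ≤-respʳ-≈

  0≤y-x : ∀ {x y} → x ≤ y → 0# ≤ y - x
  0≤y-x {x} {y} x≤y = ≤-respˡ-≈ (-‿inverseˡ x) (≤-respʳ-≈ (+-comm (- x) y) (+-monoʳ-≤ (- x) x≤y))

  0≤x+y : ∀ {x y} → 0# ≤ x → 0# ≤ y → 0# ≤ x + y
  0≤x+y {x} {y} 0≤x 0≤y = ≤-trans 0≤x (≤-from 0≤y refl)

  x≤0⇒0≤-x : ∀ {x} → x ≤ 0# → 0# ≤ - x
  x≤0⇒0≤-x x≤0 = 0≤-cong (+-identityˡ _) (0≤y-x x≤0)

  0≤-x⇒x≤0 : ∀ {x} → 0# ≤ - x → x ≤ 0#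
  0≤-x⇒x≤0 {x} 0≤-x = ≤-from 0≤-x (sym (-‿inverseʳ x))

  +-mono-≤ : ∀ {x y u v} → x ≤ y → u ≤ v → x + u ≤ y + v
  +-mono-≤ {x} {y} {u} {v} x≤y u≤v = ≤-from (0≤x+y (0≤y-x x≤y) (0≤y-x u≤v))
    (solve 4 (λ x y u v → y :+ v := x :+ u :+ (y :- x :+ (v :- u))) refl x y u v)

  *-monoˡ-≤ : ∀ {x y z} → 0# ≤ z → x ≤ y → z * x ≤ z * y
  *-monoˡ-≤ {x} {y} {z} 0≤z x≤y = ≤-from (*-nonNeg 0≤z (0≤y-x x≤y))
    (solve 3 (λ x y z → z :* y := z :* x :+ z :* (y :- x)) refl x y z)

  0≤1 : 0# ≤ 1#
  0≤1 with ≤-total 0# 1#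
  ... | inj₁ 0≤1 = 0≤1
  ... | inj₂ 1≤0 = 0≤-cong (solve 0 (:- con (+ 1) :* :- con (+ 1) := con (+ 1)) refl)
                     (*-nonNeg (x≤0⇒0≤-x 1≤0) (x≤0⇒0≤-x 1≤0))

  0<1 : 0# < 1#
  0<1 = 0≤1 , 0≉1

  <⇒≱ : ∀ {x y} → x < y → ¬ (y ≤ x)
  <⇒≱ (x≤y , x≉y) y≤x = x≉y (≤-antisym x≤y y≤x)

  ≰⇒≥ : ∀ {x y} → ¬ (x ≤ y) → y ≤ x
  ≰⇒≥ {x} {y} x≰y with ≤-total x y
  ... | inj₁ x≤y = contradiction x≤y x≰y
  ... | inj₂ y≤x = y≤x

  ≰⇒> : ∀ {x y} → ¬ (x ≤ y) → y < x
  ≰⇒> x≰y = ≰⇒≥ x≰y , λ y≈x → x≰y (≤-reflexive (sym y≈x))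

  <-≤-trans : ∀ {x y z} → x < y → y ≤ z → x < z
  <-≤-trans x<y@(x≤y , _) y≤z = ≤-trans x≤y y≤z , λ x≈z → <⇒≱ x<y (≤-respʳ-≈ (sym x≈z) y≤z)

  <-respʳ-≈ : ∀ {x y z} → y ≈ z → x < y → x < z
  <-respʳ-≈ y≈z x<y = <-≤-trans x<y (≤-reflexive y≈z)

  0<y-x : ∀ {x y} → x < y → 0# < y - x
  0<y-x {x} {y} (x≤y , x≉y) = 0≤y-x x≤y , λ 0≈y-x → x≉y
    (≈-from 1# 0≈y-x (solve 2 (λ x y → x :+ con (+ 1) :* (y :- x) := y :+ con (+ 1) :* con (+ 0)) refl x y))

  >⇒≉0 : ∀ {x} → 0# < x → ¬ (x ≈ 0#)
  >⇒≉0 (_ , 0≉x) x≈0 = 0≉x (sym x≈0)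

  0<x*y : ∀ {x y} → 0# < x → 0# < y → 0# < x * y
  0<x*y {x} {y} 0<x 0<y = *-nonNeg (proj₁ 0<x) (proj₁ 0<y) , λ 0≈x*y → >⇒≉0 0<y
    (≈-from (- (x ⁻¹)) 0≈x*y (≈-from (- y) (*-inverseʳ (>⇒≉0 0<x))
      (solve 3 (λ x y i → y :+ :- i :* (x :* y) :+ :- y :* con (+ 1) := con (+ 0) :+ :- i :* con (+ 0) :+ :- y :* (x :* i)) refl x y (x ⁻¹))))

  0<x⁻¹ : ∀ {x} → 0# < x → 0# < x ⁻¹
  0<x⁻¹ {x} 0<x = ≰⇒> λ x⁻¹≤0 → <⇒≱ 0<1 (0≤-x⇒x≤0 (0≤-cong
    (≈-from (- 1#) (*-inverseʳ (>⇒≉0 0<x))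
      (solve 2 (λ x i → x :* :- i :+ :- con (+ 1) :* con (+ 1) := :- con (+ 1) :+ :- con (+ 1) :* (x :* i)) refl x (x ⁻¹)))
    (*-nonNeg (proj₁ 0<x) (x≤0⇒0≤-x x⁻¹≤0))))

  *-cancelˡ-≤ : ∀ {x y z} → 0# < z → z * x ≤ z * y → x ≤ y
  *-cancelˡ-≤ {x} {y} {z} 0<z zx≤zy = ≤-respˡ-≈ (cancel x) (≤-respʳ-≈ (cancel y)
    (*-monoˡ-≤ (proj₁ (0<x⁻¹ 0<z)) zx≤zy))
    where
    cancel : ∀ x → z ⁻¹ * (z * x) ≈ x
    cancel x = ≈-from x (*-inverseʳ (>⇒≉0 0<z))
      (solve 3 (λ x z i → i :* (z :* x) :+ x :* con (+ 1) := x :+ x :* (z :* i)) refl x z (z ⁻¹))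

  0≤x⇒∣x∣≈x : ∀ {x} → 0# ≤ x → ∣ x ∣ ≈ x
  0≤x⇒∣x∣≈x {x} 0≤x = x≤y⇒y⊔x≈y (≤-from (0≤x+y 0≤x 0≤x) (solve 1 (λ x → x := :- x :+ (x :+ x)) refl x))

  ∣-x∣≈∣x∣ : ∀ x → ∣ - x ∣ ≈ ∣ x ∣
  ∣-x∣≈∣x∣ x = trans (⊔-comm (- x) (- - x)) (⊔-cong (solve 1 (λ x → :- :- x := x) refl x) refl)

  ∣∣-cong : ∀ {x y} → x ≈ y → ∣ x ∣ ≈ ∣ y ∣
  ∣∣-cong x≈y = ⊔-cong x≈y (-‿cong x≈y)

  ∣x∣≈0⇒x≈0 : ∀ {x} → ∣ x ∣ ≈ 0# → x ≈ 0#
  ∣x∣≈0⇒x≈0 {x} ∣x∣≈0 with ≤-total 0# x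
  ... | inj₁ 0≤x = trans (sym (0≤x⇒∣x∣≈x 0≤x)) ∣x∣≈0
  ... | inj₂ x≤0 = ≈-from (- 1#) (trans (sym (0≤x⇒∣x∣≈x (x≤0⇒0≤-x x≤0))) (trans (∣-x∣≈∣x∣ x) ∣x∣≈0))
    (solve 1 (λ x → x :+ :- con (+ 1) :* con (+ 0) := con (+ 0) :+ :- con (+ 1) :* :- x) refl x)

  0<x^n : ∀ {x} → 0# < x → ∀ n → 0# < x ^ n
  0<x^n 0<x zero    = 0<1
  0<x^n 0<x (suc n) = 0<x*y 0<x (0<x^n 0<x n)

  x^n≤1 : ∀ {x} → 0# ≤ x → x ≤ 1# → ∀ n → x ^ n ≤ 1#
  x^n≤1 0≤x x≤1 zero    = ≤-refl
  x^n≤1 {x} 0≤x x≤1 (suc n) = ≤-trans (*-monoˡ-≤ 0≤x (x^n≤1 0≤x x≤1 n)) (≤-respˡ-≈ (sym (*-identityʳ x)) x≤1)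

  _∈[0,_] : ℝ → ℝ → Set
  x ∈[0, y ] = 0# ≤ x × x ≤ y

  0∈[0,_] : ∀ {y} → 0# ≤ y → 0# ∈[0, y ]
  0∈[0, 0≤y ] = ≤-refl , 0≤y

-- Linear functionals, convex weights and cyclic indices.

module NormedPlane (R : CompleteOrderedField) where

  open Plane R hiding (zero)
  open OrderedField R
  open IntegerSolver commutativeRing

  segment : ℝ² → ℝ² → ℝ → ℝ²
  segment a b t = a +ᴹ t *ₗ (b -ᴹ a)

  linear : ℝ → ℝ → ℝ² → ℝ
  linear A B (x₁ , x₂) = A * x₁ + B * x₂

  linear-cong : ∀ A B {x y} → x ≈ᴹ y → linear A B x ≈ linear A B y
  linear-cong A B (x₁≈y₁ , x₂≈y₂) = +-cong (*-congˡ x₁≈y₁) (*-congˡ x₂≈y₂)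

  linear-neg : ∀ A B x → linear A B (-ᴹ x) ≈ - linear A B x
  linear-neg A B (x₁ , x₂) =
    solve 4 (λ A B x₁ x₂ → A :* :- x₁ :+ B :* :- x₂ := :- (A :* x₁ :+ B :* x₂)) refl A B x₁ x₂

  -- Each term contributes at least `w i * m`. For weights of sum `1#` this carries a lower bound of
  -- a linear functional from the vertices of a polygon to the whole polygon.
  linear-sum : ∀ {n} (w : Fin n → ℝ) (v : Fin n → ℝ²) A B {m} →
               (∀ i → 0# ≤ w i) → (∀ i → m ≤ linear A B (v i)) →
               Sum.sum +-commutativeMonoid w * m ≤
               linear A B (Sum.sum +ᴹ-commutativeMonoid (λ i → w i *ₗ v i))
  linear-sum {zero}  w v A B {m} 0≤w m≤ = ≤-reflexive
    (solve 3 (λ A B m → con (+ 0) :* m := A :* con (+ 0) :+ B :* con (+ 0)) refl A B m)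
  linear-sum {suc n} w v A B {m} 0≤w m≤ = ≤-from
    (0≤x+y (*-nonNeg (0≤w zero) (0≤y-x (m≤ zero)))
           (0≤y-x (linear-sum (w ∘ suc) (v ∘ suc) A B (0≤w ∘ suc) (m≤ ∘ suc))))
    (solve 9 (λ A B m w v₁ v₂ s t₁ t₂ →
      A :* (w :* v₁ :+ t₁) :+ B :* (w :* v₂ :+ t₂) :=
      (w :+ s) :* m :+ (w :* (A :* v₁ :+ B :* v₂ :- m) :+ (A :* t₁ :+ B :* t₂ :- s :* m)))
      refl A B m (w zero) (proj₁ (v zero)) (proj₂ (v zero)) _ _ _)

  indicator : ∀ {n} → Fin n → Fin n → ℝ
  indicator zero    zero    = 1#
  indicator zero    (suc _) = 0#
  indicator (suc _) zero    = 0#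
  indicator (suc i) (suc j) = indicator i j

  0≤indicator : ∀ {n} (i j : Fin n) → 0# ≤ indicator i j
  0≤indicator zero    zero    = 0≤1
  0≤indicator zero    (suc _) = ≤-refl
  0≤indicator (suc _) zero    = ≤-refl
  0≤indicator (suc i) (suc j) = 0≤indicator i j

  sum-0 : ∀ n → Sum.sum +-commutativeMonoid {n} (λ _ → 0#) ≈ 0#
  sum-0 zero    = refl
  sum-0 (suc n) = trans (+-identityˡ _) (sum-0 n)

  sum-0* : ∀ {n} (v : Fin n → ℝ²) → Sum.sum +ᴹ-commutativeMonoid (λ i → 0# *ₗ v i) ≈ᴹ 0ᴹ
  sum-0* {zero}  v = refl , refl
  sum-0* {suc n} v with sum-0* (v ∘ suc)
  ... | e₁ , e₂ = trans (+-cong (zeroˡ _) e₁) (+-identityˡ _) , trans (+-cong (zeroˡ _) e₂) (+-identityˡ _)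

  sum-indicator : ∀ {n} (i : Fin n) → Sum.sum +-commutativeMonoid (indicator i) ≈ 1#
  sum-indicator {suc n} zero    = trans (+-congˡ (sum-0 n)) (+-identityʳ _)
  sum-indicator {suc n} (suc i) = trans (+-identityˡ _) (sum-indicator i)

  sum-indicator* : ∀ {n} (v : Fin n → ℝ²) i →
                   Sum.sum +ᴹ-commutativeMonoid (λ j → indicator i j *ₗ v j) ≈ᴹ v i
  sum-indicator* v zero with sum-0* (v ∘ suc)
  ... | e₁ , e₂ = trans (+-cong (*-identityˡ _) e₁) (+-identityʳ _) ,
                  trans (+-cong (*-identityˡ _) e₂) (+-identityʳ _)
  sum-indicator* v (suc i) with sum-indicator* (v ∘ suc) i
  ... | e₁ , e₂ = trans (+-cong (zeroˡ _) e₁) (+-identityˡ _) , trans (+-cong (zeroˡ _) e₂) (+-identityˡ _)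

  third : ∀ {n} (i j : Fin (3 ℕ.+ n)) → ∃[ k ] (k ≢ i × k ≢ j)
  third zero          zero          = suc zero , (λ ()) , (λ ())
  third zero          (suc zero)    = suc (suc zero) , (λ ()) , (λ ())
  third zero          (suc (suc _)) = suc zero , (λ ()) , (λ ())
  third (suc zero)    zero          = suc (suc zero) , (λ ()) , (λ ())
  third (suc (suc _)) zero          = suc zero , (λ ()) , (λ ())
  third (suc _)       (suc _)       = zero , (λ ()) , (λ ())

  -- From `j` it takes `suc n ∸ toℕ j` steps to come round to index 0, and `toℕ k` more to arrive at
  -- `k`. The invariant of `reach` is that `k` is congruent to the current index plus the number of
  -- remaining steps.
  next-induction : ∀ {n} (P : Fin (suc n) → Set) → (∀ j → P j → P (next j)) →
                   ∀ {j} → P j → ∀ k → P k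
  next-induction {n} P P-next {j} Pj k =
    reach (suc n ℕ.∸ toℕ j ℕ.+ toℕ k) Pj (begin
      toℕ k                                             ≡⟨ ℕ.m<n⇒m%n≡m (Fin.toℕ<n k) ⟨
      toℕ k ℕ.% suc n                                   ≡⟨ ℕ.[m+n]%n≡m%n (toℕ k) (suc n) ⟨
      (toℕ k ℕ.+ suc n) ℕ.% suc n                       ≡⟨ ≡.cong (ℕ._% suc n) (ℕ.+-comm (toℕ k) (suc n)) ⟩
      (suc n ℕ.+ toℕ k) ℕ.% suc n
        ≡⟨ ≡.cong (λ m → (m ℕ.+ toℕ k) ℕ.% suc n) (ℕ.m+[n∸m]≡n (ℕ.<⇒≤ (Fin.toℕ<n j))) ⟨
      (toℕ j ℕ.+ (suc n ℕ.∸ toℕ j) ℕ.+ toℕ k) ℕ.% suc n ≡⟨ ≡.cong (ℕ._% suc n) (ℕ.+-assoc (toℕ j) _ _) ⟩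
      (toℕ j ℕ.+ (suc n ℕ.∸ toℕ j ℕ.+ toℕ k)) ℕ.% suc n ∎)
    where
    open ≡.≡-Reasoning
    reach : ∀ m {j} → P j → toℕ k ≡ (toℕ j ℕ.+ m) ℕ.% suc n → P k
    reach zero {j} Pj k≡ = ≡.subst P (Fin.toℕ-injective (begin
      toℕ j                       ≡⟨ ℕ.m<n⇒m%n≡m (Fin.toℕ<n j) ⟨
      toℕ j ℕ.% suc n             ≡⟨ ≡.cong (ℕ._% suc n) (ℕ.+-identityʳ (toℕ j)) ⟨
      (toℕ j ℕ.+ 0) ℕ.% suc n     ≡⟨ k≡ ⟨
      toℕ k                       ∎)) Pj
    reach (suc m) {j} Pj k≡ = reach m (P-next j Pj) (begin
      toℕ k                                           ≡⟨ k≡ ⟩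
      (toℕ j ℕ.+ suc m) ℕ.% suc n                     ≡⟨ ≡.cong (ℕ._% suc n) (ℕ.+-suc (toℕ j) m) ⟩
      (suc (toℕ j) ℕ.+ m) ℕ.% suc n                   ≡⟨ ℕ.%-distribˡ-+ (suc (toℕ j)) m (suc n) ⟩
      (suc (toℕ j) ℕ.% suc n ℕ.+ m ℕ.% suc n) ℕ.% suc n
        ≡⟨ ≡.cong (λ l → (l ℕ.+ m ℕ.% suc n) ℕ.% suc n) (ℕ.m%n%n≡m%n (suc (toℕ j)) (suc n)) ⟨
      (suc (toℕ j) ℕ.% suc n ℕ.% suc n ℕ.+ m ℕ.% suc n) ℕ.% suc n
        ≡⟨ ℕ.%-distribˡ-+ (suc (toℕ j) ℕ.% suc n) m (suc n) ⟨
      (suc (toℕ j) ℕ.% suc n ℕ.+ m) ℕ.% suc n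
        ≡⟨ ≡.cong (λ l → (l ℕ.+ m) ℕ.% suc n) (Fin.toℕ-fromℕ< (ℕ.m%n<n (suc (toℕ j)) (suc n))) ⟨
      (toℕ (next j) ℕ.+ m) ℕ.% suc n                  ∎)

  -- Elementary properties of a norm.

  module NormProperties (N : Norm) where

    open Norm N

    ∥-x∥≈∥x∥ : ∀ x → ∥ -ᴹ x ∥ ≈ ∥ x ∥
    ∥-x∥≈∥x∥ x@(x₁ , x₂) = begin
      ∥ -ᴹ x ∥               ≈⟨ ∥∥-cong (e x₁ , e x₂) ⟩
      ∥ (- 1#) *ₗ x ∥        ≈⟨ homogeneous (- 1#) x ⟩
      ∣ - 1# ∣ * ∥ x ∥       ≈⟨ *-congʳ (trans (∣-x∣≈∣x∣ 1#) (0≤x⇒∣x∣≈x 0≤1)) ⟩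
      1# * ∥ x ∥             ≈⟨ *-identityˡ _ ⟩
      ∥ x ∥                  ∎
      where
      open import Relation.Binary.Reasoning.Setoid ℝ-setoid
      e = solve 1 (λ x → :- x := :- con (+ 1) :* x) refl

    ∥a*x∥≈a*∥x∥ : ∀ {a} → 0# ≤ a → ∀ x → ∥ a *ₗ x ∥ ≈ a * ∥ x ∥
    ∥a*x∥≈a*∥x∥ 0≤a x = trans (homogeneous _ x) (*-congʳ (0≤x⇒∣x∣≈x 0≤a))

    dist-comm : ∀ x y → dist x y ≈ dist y x
    dist-comm x@(x₁ , x₂) y@(y₁ , y₂) = trans (∥∥-cong (e x₁ y₁ , e x₂ y₂)) (∥-x∥≈∥x∥ (y -ᴹ x))
      where e = solve 2 (λ x y → x :- y := :- (y :- x)) refl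

    dist≈0⇒≈ : ∀ {x y} → dist x y ≈ 0# → x ≈ᴹ y
    dist≈0⇒≈ {x₁ , x₂} {y₁ , y₂} d≈0 with definite _ d≈0
    ... | e₁ , e₂ = ≈-from 1# e₁ (e x₁ y₁) , ≈-from 1# e₂ (e x₂ y₂)
      where e = solve 2 (λ x y → x :+ con (+ 1) :* con (+ 0) := y :+ con (+ 1) :* (x :- y)) refl

    ∥0∥≈0 : ∥ 0ᴹ ∥ ≈ 0#
    ∥0∥≈0 = trans (∥∥-cong (sym (zeroˡ 0#) , sym (zeroˡ 0#)))
              (trans (∥a*x∥≈a*∥x∥ ≤-refl 0ᴹ) (zeroˡ _))

    -- For unit vectors a and b: the segment from a to b lies on the unit circle.
    Additive : ℝ² → ℝ² → Set
    Additive a b = ∀ {α β} → 0# ≤ α → 0# ≤ β → ∥ α *ₗ a +ᴹ β *ₗ b ∥ ≈ α + β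

    additive-neg : ∀ {a b} → Additive a b → Additive (-ᴹ a) (-ᴹ b)
    additive-neg {a@(a₁ , a₂)} {b@(b₁ , b₂)} add {α} {β} 0≤α 0≤β =
      trans (∥∥-cong (e α β a₁ b₁ , e α β a₂ b₂)) (trans (∥-x∥≈∥x∥ (α *ₗ a +ᴹ β *ₗ b)) (add 0≤α 0≤β))
      where e = solve 4 (λ α β a b → α :* :- a :+ β :* :- b := :- (α :* a :+ β :* b)) refl

  -- Geometry of the polygonal unit disc.

  module PolygonalNorm (em : ExcludedMiddle 0ℓ) {N : Norm} (polygonal : Polygonal N) where

    open Norm N
    open NormProperties N
    open Polygonal polygonal

    V V⁺ : Fin size → ℝ²
    V = vertex
    V⁺ i = vertex (next i)

    region-bound : ∀ A B {m} → (∀ i → m ≤ linear A B (V i)) → ∀ {x} → x ∈ unitDisc → m ≤ linear A B x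
    region-bound A B {m} m≤ x∈D with proj₁ unitDisc≐polygon x∈D
    ... | w , 0≤w , Σw≈1 , Σwv≈x =
      ≤-respˡ-≈ (trans (*-congʳ Σw≈1) (*-identityˡ m))
        (≤-respʳ-≈ (linear-cong A B Σwv≈x) (linear-sum w V A B 0≤w m≤))

    vertex∈unitDisc : ∀ i → V i ∈ unitDisc
    vertex∈unitDisc i = proj₂ unitDisc≐polygon
      (indicator i , 0≤indicator i , sum-indicator i , sum-indicator* V i)

    -vertex∈unitDisc : ∀ i → (-ᴹ V i) ∈ unitDisc
    -vertex∈unitDisc i = ≤-respˡ-≈ (sym (∥-x∥≈∥x∥ (V i))) (vertex∈unitDisc i)

    cross : ℝ² → ℝ² → ℝ
    cross (a₁ , a₂) (b₁ , b₂) = a₁ * b₂ - a₂ * b₁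

    -- Twice the signed area of the triangle `0ᴹ`, `V i`, `V⁺ i`.
    h : Fin size → ℝ
    h i = cross (V i) (V⁺ i)

    -- linear (A i) (B i) x = - h i is the equation of the line through side i.
    A B : Fin size → ℝ
    A i = proj₂ (V i) - proj₂ (V⁺ i)
    B i = proj₁ (V⁺ i) - proj₁ (V i)

    orient≈ : ∀ i x → orient (V i) (V⁺ i) x ≈ linear (A i) (B i) x - (- h i)
    orient≈ i (x₁ , x₂) = solve 6 (λ a₁ a₂ b₁ b₂ c₁ c₂ →
      (b₁ :- a₁) :* (c₂ :- a₂) :- (b₂ :- a₂) :* (c₁ :- a₁) :=
      (a₂ :- b₂) :* c₁ :+ (b₁ :- a₁) :* c₂ :- :- (a₁ :* b₂ :- a₂ :* b₁))
      refl (proj₁ (V i)) (proj₂ (V i)) (proj₁ (V⁺ i)) (proj₂ (V⁺ i)) x₁ x₂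

    linear-vertex : ∀ i k → - h i ≤ linear (A i) (B i) (V k)
    linear-vertex i k with k Fin.≟ i | k Fin.≟ next i
    ... | yes ≡.refl | _ = ≤-reflexive (solve 4 (λ a₁ a₂ b₁ b₂ →
      :- (a₁ :* b₂ :- a₂ :* b₁) := (a₂ :- b₂) :* a₁ :+ (b₁ :- a₁) :* a₂)
      refl (proj₁ (V i)) (proj₂ (V i)) (proj₁ (V⁺ i)) (proj₂ (V⁺ i)))
    ... | no _ | yes ≡.refl = ≤-reflexive (solve 4 (λ a₁ a₂ b₁ b₂ →
      :- (a₁ :* b₂ :- a₂ :* b₁) := (a₂ :- b₂) :* b₁ :+ (b₁ :- a₁) :* b₂)
      refl (proj₁ (V i)) (proj₂ (V i)) (proj₁ (V⁺ i)) (proj₂ (V⁺ i)))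
    ... | no k≢i | no k≢i⁺ = ≤-from (0≤-cong (orient≈ i (V k)) (proj₁ (convex i k k≢i k≢i⁺)))
      (solve 2 (λ x y → y := x :+ (y :- x)) refl _ _)

    -- Take a vertex `V k` off side `i`. The disc is symmetric, so `V k` and `-ᴹ V k` both lie in
    -- the half-plane of side `i`, the former strictly inside. Hence `linear (A i) (B i) (V k)` is
    -- greater than `- h i` and at most `h i`.
    0<h : ∀ i → 0# < h i
    0<h i with third i (next i)
    ... | k , k≢i , k≢i⁺ = ≰⇒> λ h≤0 → <⇒≱ (convex i k k≢i k≢i⁺)
      (0≤-x⇒x≤0 (0≤-cong
        (trans (solve 2 (λ h l → :- l :- :- h :+ (:- h :+ :- h) := :- (l :- :- h)) refl
                 (h i) (linear (A i) (B i) (V k)))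
               (-‿cong (sym (orient≈ i (V k)))))
        (0≤x+y (0≤y-x (≤-respʳ-≈ (linear-neg (A i) (B i) (V k))
                 (region-bound (A i) (B i) (linear-vertex i) (-vertex∈unitDisc k))))
               (0≤x+y (x≤0⇒0≤-x h≤0) (x≤0⇒0≤-x h≤0)))))

    -- This is the half-plane bound for `x` divided by its norm, scaled back. The zero vector cannot
    -- be normalised and is treated apart.
    linear≤h*norm : ∀ i x → - linear (A i) (B i) x ≤ h i * ∥ x ∥
    linear≤h*norm i x@(x₁ , x₂) with em {P = ∥ x ∥ ≈ 0#}
    ... | yes ∥x∥≈0 = ≤-reflexive (trans
      (-‿cong (linear-cong (A i) (B i) (definite x ∥x∥≈0)))
      (trans (solve 3 (λ A B h → :- (A :* con (+ 0) :+ B :* con (+ 0)) := h :* con (+ 0)) refl (A i) (B i) (h i))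
             (*-congˡ (sym ∥x∥≈0))))
    ... | no  ∥x∥≉0 = ≤-from (*-nonNeg (nonNegative x) (0≤y-x bound))
      (≈-from (- linear (A i) (B i) x) (*-inverseʳ ∥x∥≉0)
        (solve 7 (λ A B x₁ x₂ h n n⁻¹ →
          h :* n :+ :- (A :* x₁ :+ B :* x₂) :* con (+ 1) :=
          :- (A :* x₁ :+ B :* x₂) :+ n :* (A :* (n⁻¹ :* x₁) :+ B :* (n⁻¹ :* x₂) :- :- h)
            :+ :- (A :* x₁ :+ B :* x₂) :* (n :* n⁻¹))
          refl (A i) (B i) x₁ x₂ (h i) (∥ x ∥) (∥ x ∥ ⁻¹)))
      where
      0<∥x∥ : 0# < ∥ x ∥
      0<∥x∥ = nonNegative x , λ 0≈∥x∥ → ∥x∥≉0 (sym 0≈∥x∥)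
      bound = region-bound (A i) (B i) (linear-vertex i) {∥ x ∥ ⁻¹ *ₗ x} (≤-reflexive
        (trans (∥a*x∥≈a*∥x∥ (proj₁ (0<x⁻¹ 0<∥x∥)) x) (trans (*-comm _ _) (*-inverseʳ ∥x∥≉0))))

    -- One bound is the triangle inequality. For the other, `- linear (A i) (B i)` equals `h i` at
    -- both ends of the side, hence `h i * (α + β)` at the combination, and it is at most `h i`
    -- times the norm.
    additive-side : ∀ i → Additive (V i) (V⁺ i)
    additive-side i {α} {β} 0≤α 0≤β = ≤-antisym upper lower
      where
      x : ℝ²
      x = α *ₗ V i +ᴹ β *ₗ V⁺ i
      upper : ∥ x ∥ ≤ α + β
      upper = ≤-trans (triangle _ _) (+-mono-≤ (scaled 0≤α i) (scaled 0≤β (next i)))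
        where
        scaled : ∀ {γ} → 0# ≤ γ → ∀ k → ∥ γ *ₗ V k ∥ ≤ γ
        scaled {γ} 0≤γ k = ≤-respˡ-≈ (sym (∥a*x∥≈a*∥x∥ 0≤γ (V k)))
          (≤-respʳ-≈ (*-identityʳ γ) (*-monoˡ-≤ 0≤γ (vertex∈unitDisc k)))
      lower : α + β ≤ ∥ x ∥
      lower = *-cancelˡ-≤ (0<h i) (≤-respˡ-≈
        (solve 6 (λ a₁ a₂ b₁ b₂ α β →
          :- ((a₂ :- b₂) :* (α :* a₁ :+ β :* b₁) :+ (b₁ :- a₁) :* (α :* a₂ :+ β :* b₂)) :=
          (a₁ :* b₂ :- a₂ :* b₁) :* (α :+ β))
          refl (proj₁ (V i)) (proj₂ (V i)) (proj₁ (V⁺ i)) (proj₂ (V⁺ i)) α β)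
        (linear≤h*norm i x))

    -- Non-negativity extends from the vertices to the disc, which contains `-ᴹ V i` by symmetry.
    nonNeg⇒nonPos : ∀ A B → (∀ i → 0# ≤ linear A B (V i)) → ∀ i → linear A B (V i) ≤ 0#
    nonNeg⇒nonPos A B 0≤ i = 0≤-x⇒x≤0 (0≤-cong (linear-neg A B (V i)) (region-bound A B 0≤ (-vertex∈unitDisc i)))

    -- Going once around the polygon, i ↦ cross (V i) d changes sign from + to − at
    -- some side, and that side is the one whose cone contains d.
    crossing : ∀ d → ∃[ i ] (0# ≤ cross (V i) d × cross (V⁺ i) d ≤ 0#)
    crossing d@(d₁ , d₂) with em {P = ∃[ i ] (0# ≤ cross (V i) d × cross (V⁺ i) d ≤ 0#)}
    ... | yes found = found
    -- Without a sign change non-negativity spreads around the whole polygon. By symmetry all values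
    -- are then non-positive too, so any side qualifies.
    ... | no  none  = zero , all-nonNeg zero , ≤-respˡ-≈ (toCross (next zero))
            (nonNeg⇒nonPos d₂ (- d₁) (λ i → ≤-respʳ-≈ (sym (toCross i)) (all-nonNeg i)) (next zero))
      where
      toCross : ∀ i → linear d₂ (- d₁) (V i) ≈ cross (V i) d
      toCross i = solve 4 (λ d₁ d₂ v₁ v₂ → d₂ :* v₁ :+ :- d₁ :* v₂ := v₁ :* d₂ :- v₂ :* d₁) refl
        d₁ d₂ (proj₁ (V i)) (proj₂ (V i))
      toCross⁻ : ∀ i → linear (- d₂) d₁ (V i) ≈ - cross (V i) d
      toCross⁻ i = solve 4 (λ d₁ d₂ v₁ v₂ → :- d₂ :* v₁ :+ d₁ :* v₂ := :- (v₁ :* d₂ :- v₂ :* d₁)) refl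
        d₁ d₂ (proj₁ (V i)) (proj₂ (V i))
      nonNeg-next : ∀ i → 0# ≤ cross (V i) d → 0# ≤ cross (V⁺ i) d
      nonNeg-next i 0≤c = ≰⇒≥ λ c⁺≤0 → none (i , 0≤c , c⁺≤0)
      -- A starting point for the spreading: symmetry of the disc rules out that all values are
      -- negative.
      some-nonNeg : ∃[ i ] 0# ≤ cross (V i) d
      some-nonNeg with em {P = ∃[ i ] 0# ≤ cross (V i) d}
      ... | yes found = found
      ... | no  none′ = zero , 0≤-cong (-‿involutive _)
              (x≤0⇒0≤-x (≤-respˡ-≈ (toCross⁻ zero) (nonNeg⇒nonPos (- d₂) d₁
                (λ i → ≤-respʳ-≈ (sym (toCross⁻ i)) (x≤0⇒0≤-x (≰⇒≥ λ 0≤c → none′ (i , 0≤c)))) zero)))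
        where -‿involutive = solve 1 (λ x → :- :- x := x) refl
      all-nonNeg : ∀ i → 0# ≤ cross (V i) d
      all-nonNeg = next-induction (λ i → 0# ≤ cross (V i) d) nonNeg-next (proj₂ some-nonNeg)

    -- Cramer's rule in the basis `V i`, `V⁺ i` for the side given by `crossing`. The sign change
    -- makes both coordinates non-negative, and additivity turns `∥ d ∥ ≈ 1#` into `α + β ≈ 1#`.
    unit-on-side : ∀ d → ∥ d ∥ ≈ 1# → Σ[ i ∈ Fin size ] ∃[ t ] (t ∈[0, 1# ] × d ≈ᴹ segment (V i) (V⁺ i) t)
    unit-on-side d@(d₁ , d₂) ∥d∥≈1 with crossing d
    ... | i , 0≤v×d , v⁺×d≤0 = i , β , (0≤β , ≤-from 0≤α (trans (sym α+β≈1) (+-comm α β))) ,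
        (onSegment a₁ b₁ (proj₁ d≈) , onSegment a₂ b₂ (proj₂ d≈))
      where
      a₁ = proj₁ (V i)
      a₂ = proj₂ (V i)
      b₁ = proj₁ (V⁺ i)
      b₂ = proj₂ (V⁺ i)
      h⁻¹ = h i ⁻¹
      α β : ℝ
      α = h⁻¹ * - cross (V⁺ i) d
      β = h⁻¹ * cross (V i) d
      0≤α : 0# ≤ α
      0≤α = *-nonNeg (proj₁ (0<x⁻¹ (0<h i))) (x≤0⇒0≤-x v⁺×d≤0)
      0≤β : 0# ≤ β
      0≤β = *-nonNeg (proj₁ (0<x⁻¹ (0<h i))) 0≤v×d
      d≈ : d ≈ᴹ α *ₗ V i +ᴹ β *ₗ V⁺ i
      d≈ = ≈-from (- d₁) (*-inverseʳ (>⇒≉0 (0<h i)))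
             (solve 7 (λ a₁ a₂ b₁ b₂ d₁ d₂ h⁻¹ →
               d₁ :+ :- d₁ :* con (+ 1) :=
               h⁻¹ :* :- (b₁ :* d₂ :- b₂ :* d₁) :* a₁ :+ h⁻¹ :* (a₁ :* d₂ :- a₂ :* d₁) :* b₁
                 :+ :- d₁ :* ((a₁ :* b₂ :- a₂ :* b₁) :* h⁻¹))
               refl a₁ a₂ b₁ b₂ d₁ d₂ h⁻¹)
         , ≈-from (- d₂) (*-inverseʳ (>⇒≉0 (0<h i)))
             (solve 7 (λ a₁ a₂ b₁ b₂ d₁ d₂ h⁻¹ →
               d₂ :+ :- d₂ :* con (+ 1) :=
               h⁻¹ :* :- (b₁ :* d₂ :- b₂ :* d₁) :* a₂ :+ h⁻¹ :* (a₁ :* d₂ :- a₂ :* d₁) :* b₂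
                 :+ :- d₂ :* ((a₁ :* b₂ :- a₂ :* b₁) :* h⁻¹))
               refl a₁ a₂ b₁ b₂ d₁ d₂ h⁻¹)
      α+β≈1 : α + β ≈ 1#
      α+β≈1 = trans (sym (additive-side i 0≤α 0≤β)) (trans (sym (∥∥-cong d≈)) ∥d∥≈1)
      onSegment : ∀ a b {d} → d ≈ α * a + β * b → d ≈ a + β * (b - a)
      onSegment a b d≈ = trans d≈ (≈-from a α+β≈1
        (solve 4 (λ α β a b → α :* a :+ β :* b :+ a :* con (+ 1) := a :+ β :* (b :- a) :+ a :* (α :+ β)) refl α β a b))

≢⇒≡opposite : ∀ {i j : Fin 2} → i ≢ j → i ≡ opposite j
≢⇒≡opposite {zero}     {zero}     i≢j = contradiction ≡.refl i≢j
≢⇒≡opposite {zero}     {suc zero} i≢j = ≡.refl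
≢⇒≡opposite {suc zero} {zero}     i≢j = ≡.refl
≢⇒≡opposite {suc zero} {suc zero} i≢j = contradiction ≡.refl i≢j

opposite≢ : ∀ (i : Fin 2) → i ≢ opposite i
opposite≢ zero       ()
opposite≢ (suc zero) ()

-- Copies of the progression as sequences and chains.

module Progressions (R : CompleteOrderedField) (N : Plane.Norm R) (q : Plane.ℝ R) where

  open Plane R hiding (zero)
  open OrderedField R
  open NormedPlane R
  open NormProperties N
  open Norm N
  open IntegerSolver commutativeRing

  -- Unlike `HasMonochromaticCopy`, which quantifies over predicates, this lives in `Set`, so
  -- excluded middle at level `0ℓ` applies to it.
  MonochromaticSequence : ∀ {k} → Colouring k → Set
  MonochromaticSequence {k} c = Σ[ p ∈ (ℕ → ℝ²) ] Σ[ γ ∈ Fin k ]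
    (∀ m → Func.to c (p m) ≡ γ) ×
    (∀ m n → dist (p m) (p n) ≈ ∣ partialSum q m - partialSum q n ∣)

  -- The copy is the image of `p`, and the bijection reads the index off the membership proof. It
  -- respects equality and is injective because it preserves distances and points at distance zero
  -- coincide.
  sequence⇒copy : ∀ {k} (c : Colouring k) → MonochromaticSequence c → HasMonochromaticCopy N (𝒢 q) c
  sequence⇒copy c (p , γ , mono , isometric) =
    (λ x → ∃[ n ] x ≈ᴹ p n) ,
    (record
      { to        = λ (x , n , _) → p n , n , refl , refl
      ; cong      = λ {x} {y} → to-cong {x} {y}
      ; bijective =
          (λ {x} {y} p≈ → ≈-from 1#
            (∣x∣≈0⇒x≈0 (trans (sym (distance x y)) (trans (∥∥-cong (minus-self p≈)) ∥0∥≈0)))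
            (solve 2 (λ x y → x :+ con (+ 1) :* con (+ 0) := y :+ con (+ 1) :* (x :- y)) refl _ _)) ,
          (λ (y , n , y≈) → (partialSum q n , n , refl) , λ {z} z≈ →
            let e₁ , e₂ = to-cong {z} {partialSum q n , n , refl} z≈ in
            trans e₁ (sym (proj₁ y≈)) , trans e₂ (sym (proj₂ y≈)))
      } , distance) ,
    γ , λ x (n , x≈) → ≡.trans (Func.cong c x≈) (mono n)
    where
    distance : ∀ (x y : ∃ (𝒢 q)) → dist (p (proj₁ (proj₂ x))) (p (proj₁ (proj₂ y))) ≈ ∣ proj₁ x - proj₁ y ∣
    distance (x , m , x≈) (y , n , y≈) =
      trans (isometric m n) (∣∣-cong (+-cong (sym x≈) (-‿cong (sym y≈))))
    to-cong : ∀ {x y : ∃ (𝒢 q)} → proj₁ x ≈ proj₁ y → p (proj₁ (proj₂ x)) ≈ᴹ p (proj₁ (proj₂ y))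
    to-cong {x} {y} x≈y = dist≈0⇒≈ (trans (distance x y) (trans
      (∣∣-cong (≈-from 1# x≈y (solve 2 (λ x y → x :- y :+ con (+ 1) :* y := con (+ 0) :+ con (+ 1) :* x) refl _ _)))
      (0≤x⇒∣x∣≈x ≤-refl)))
    minus-self : ∀ {x y : ℝ²} → x ≈ᴹ y → x -ᴹ y ≈ᴹ 0ᴹ
    minus-self (e₁ , e₂) = trans (+-congʳ e₁) (-‿inverseʳ _) , trans (+-congʳ e₂) (-‿inverseʳ _)

  -- The last terms of a copy of the progression, from index n on, whose steps
  -- (taken backwards) all point into the segment from a to b.
  Chain : ∀ {k} → Colouring k → ℕ → ℝ² → ℝ² → Fin k → Set
  Chain c n a b γ = Σ[ p ∈ (ℕ → ℝ²) ] (∀ m → Func.to c (p m) ≡ γ) ×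
    (∀ m → ∃[ t ] (t ∈[0, 1# ] × p m ≈ᴹ p (suc m) +ᴹ q ^ (n ℕ.+ m) *ₗ segment a b t))

  module _ {k} (c : Colouring k) {a b : ℝ²} {γ : Fin k} where

    prepend : ∀ n {t} (chain : Chain c (suc n) a b γ) → t ∈[0, 1# ] →
              Func.to c (proj₁ chain 0 +ᴹ q ^ n *ₗ segment a b t) ≡ γ → Chain c n a b γ
    prepend n {t} (p , mono , steps) t∈ first = p′ , mono′ , steps′
      where
      p′ : ℕ → ℝ²
      p′ zero    = p 0 +ᴹ q ^ n *ₗ segment a b t
      p′ (suc m) = p m
      mono′ : ∀ m → Func.to c (p′ m) ≡ γ
      mono′ zero    = first
      mono′ (suc m) = mono m
      steps′ : ∀ m → ∃[ t ] (t ∈[0, 1# ] × p′ m ≈ᴹ p′ (suc m) +ᴹ q ^ (n ℕ.+ m) *ₗ segment a b t)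
      steps′ zero    = t , t∈ ,
        ≡.subst (λ l → p′ 0 ≈ᴹ p 0 +ᴹ q ^ l *ₗ segment a b t) (≡.sym (ℕ.+-identityʳ n)) (refl , refl)
      steps′ (suc m) with steps m
      ... | u , u∈ , e = u , u∈ ,
        ≡.subst (λ l → p m ≈ᴹ p (suc m) +ᴹ q ^ l *ₗ segment a b u) (≡.sym (ℕ.+-suc n m)) e

    -- A step of index `l` adds `q ^ l * (1# - t)` to the coefficient of `a` and `q ^ l * t` to that
    -- of `b`. All coefficients are non-negative, so additivity gives the difference of two terms
    -- the norm `α + β`, a difference of partial sums.
    chain⇒sequence : 0# < q → Additive a b → Chain c 0 a b γ → MonochromaticSequence c
    chain⇒sequence 0<q additive (p , mono , steps) = p , γ , mono , isometric
      where
      a₁ = proj₁ a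
      a₂ = proj₂ a
      b₁ = proj₁ b
      b₂ = proj₂ b
      S = partialSum q
      advance : ∀ m r → ∃[ α ] ∃[ β ] (0# ≤ α × 0# ≤ β × α + β ≈ S (r ℕ.+ m) - S m ×
                p m ≈ᴹ p (r ℕ.+ m) +ᴹ (α *ₗ a +ᴹ β *ₗ b))
      advance m zero = 0# , 0# , ≤-refl , ≤-refl ,
        solve 1 (λ s → con (+ 0) :+ con (+ 0) := s :- s) refl (S m) ,
        (e (proj₁ (p m)) a₁ b₁ , e (proj₂ (p m)) a₂ b₂)
        where e = solve 3 (λ p a b → p := p :+ (con (+ 0) :* a :+ con (+ 0) :* b)) refl
      advance m (suc r) with advance m r | steps (r ℕ.+ m)
      ... | α , β , 0≤α , 0≤β , α+β≈ , e₁ , e₂ | t , (0≤t , t≤1) , f₁ , f₂ =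
        α + Q * (1# - t) , β + Q * t ,
        0≤x+y 0≤α (*-nonNeg 0≤Q (0≤y-x t≤1)) , 0≤x+y 0≤β (*-nonNeg 0≤Q 0≤t) ,
        ≈-from 1# α+β≈
          (solve 6 (λ α β Q t s s′ → α :+ Q :* (con (+ 1) :- t) :+ (β :+ Q :* t) :+ con (+ 1) :* (s′ :- s) :=
                     s′ :+ Q :- s :+ con (+ 1) :* (α :+ β))
            refl α β Q t (S m) (S (r ℕ.+ m))) ,
        (trans e₁ (trans (+-congʳ f₁) (g _ a₁ b₁)) , trans e₂ (trans (+-congʳ f₂) (g _ a₂ b₂)))
        where
        Q = q ^ (r ℕ.+ m)
        0≤Q : 0# ≤ Q
        0≤Q = proj₁ (0<x^n 0<q (r ℕ.+ m))
        g : ∀ p a b → p + Q * (a + t * (b - a)) + (α * a + β * b) ≈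
                      p + ((α + Q * (1# - t)) * a + (β + Q * t) * b)
        g = solve 7 (λ α β Q t p a b → p :+ Q :* (a :+ t :* (b :- a)) :+ (α :* a :+ β :* b) :=
              p :+ ((α :+ Q :* (con (+ 1) :- t)) :* a :+ (β :+ Q :* t) :* b)) refl α β Q t

      forward : ∀ m r → dist (p m) (p (r ℕ.+ m)) ≈ ∣ S m - S (r ℕ.+ m) ∣
      forward m r with advance m r
      ... | α , β , 0≤α , 0≤β , α+β≈ , e₁ , e₂ = begin
        dist (p m) (p (r ℕ.+ m))     ≈⟨ ∥∥-cong (difference e₁ , difference e₂) ⟩
        ∥ α *ₗ a +ᴹ β *ₗ b ∥         ≈⟨ additive 0≤α 0≤β ⟩
        α + β                        ≈⟨ 0≤x⇒∣x∣≈x (0≤x+y 0≤α 0≤β) ⟨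
        ∣ α + β ∣                    ≈⟨ ∣∣-cong α+β≈ ⟩
        ∣ S (r ℕ.+ m) - S m ∣        ≈⟨ ∣-x∣≈∣x∣ _ ⟨
        ∣ - (S (r ℕ.+ m) - S m) ∣    ≈⟨ ∣∣-cong (solve 2 (λ x y → :- (x :- y) := y :- x) refl _ _) ⟩
        ∣ S m - S (r ℕ.+ m) ∣        ∎
        where
        open import Relation.Binary.Reasoning.Setoid ℝ-setoid
        difference : ∀ {x y z} → x ≈ y + z → x - y ≈ z
        difference x≈ = ≈-from 1# x≈
          (solve 3 (λ x y z → x :- y :+ con (+ 1) :* (y :+ z) := z :+ con (+ 1) :* x) refl _ _ _)

      isometric : ∀ m n → dist (p m) (p n) ≈ ∣ S m - S n ∣
      isometric m n with ℕ.≤-total m n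
      ... | inj₁ m≤n = ≡.subst (λ l → dist (p m) (p l) ≈ ∣ S m - S l ∣) (ℕ.m∸n+n≡m m≤n) (forward m (n ℕ.∸ m))
      ... | inj₂ n≤m = trans (dist-comm (p m) (p n)) (trans
        (≡.subst (λ l → dist (p n) (p l) ≈ ∣ S n - S l ∣) (ℕ.m∸n+n≡m n≤m) (forward n (m ℕ.∸ n)))
        (trans (sym (∣-x∣≈∣x∣ _)) (∣∣-cong (solve 2 (λ x y → :- (x :- y) := y :- x) refl (S n) (S m)))))

-- Two-colourings: constants, uniform translates and strips.

module Ramsey (em : ExcludedMiddle 0ℓ) (R : CompleteOrderedField) where

  open Plane R hiding (zero)

  module TwoColouring
    (N : Norm) (polygonal : Polygonal N)
    (side : ℝ) (isSmallest : Polygonal.IsSmallestSideLength polygonal side)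
    (q : ℝ) (0<q : 0# < q) (q<side/1+side : q < side / (1# + side))
    (c : Colouring 2) where

    open OrderedField R
    open NormedPlane R
    open Norm N
    open NormProperties N
    open PolygonalNorm em polygonal
    open Polygonal polygonal using (size; sideLength)
    open Progressions R N q
    open IntegerSolver commutativeRing

    open Func c using () renaming (to to colour; cong to colour-cong)

    ρ : ℝ
    ρ = q * (1# - q) ⁻¹

    0≤side : 0# ≤ side
    0≤side with proj₂ isSmallest
    ... | i , side≈ = 0≤-cong (sym side≈) (nonNegative _)

    -- The upper bound on `q`, cleared of its denominator.
    0<side*[1-q]-q : 0# < side * (1# - q) - q
    0<side*[1-q]-q = <-respʳ-≈
      (≈-from side (*-inverseʳ (>⇒≉0 0<1+side))
        (solve 3 (λ s q i → (s :* i :- q) :* (con (+ 1) :+ s) :+ s :* con (+ 1) :=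
                   s :* (con (+ 1) :- q) :- q :+ s :* ((con (+ 1) :+ s) :* i))
          refl side q ((1# + side) ⁻¹)))
      (0<x*y (0<y-x q<side/1+side) 0<1+side)
      where
      0<1+side : 0# < 1# + side
      0<1+side = <-≤-trans 0<1 (≤-from 0≤side refl)

    0<1-q : 0# < 1# - q
    0<1-q = ≰⇒> λ 1-q≤0 → <⇒≱ 0<side*[1-q]-q (0≤-x⇒x≤0 (0≤-cong
      (solve 2 (λ s q → s :* :- (con (+ 1) :- q) :+ q := :- (s :* (con (+ 1) :- q) :- q)) refl side q)
      (0≤x+y (*-nonNeg 0≤side (x≤0⇒0≤-x 1-q≤0)) (proj₁ 0<q))))

    q≤1 : q ≤ 1#
    q≤1 = ≤-from (proj₁ 0<1-q) (solve 1 (λ q → con (+ 1) := q :+ (con (+ 1) :- q)) refl q)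

    ρ*[1-q]≈q : ρ * (1# - q) ≈ q
    ρ*[1-q]≈q = ≈-from q (*-inverseʳ (>⇒≉0 0<1-q))
      (solve 3 (λ q u i → q :* i :* u :+ q :* con (+ 1) := q :+ q :* (u :* i)) refl q (1# - q) ((1# - q) ⁻¹))

    0≤ρ : 0# ≤ ρ
    0≤ρ = *-nonNeg (proj₁ 0<q) (proj₁ (0<x⁻¹ 0<1-q))

    0<side-ρ : 0# < side - ρ
    0<side-ρ = <-respʳ-≈
      (≈-from side (*-inverseʳ (>⇒≉0 0<1-q))
        (solve 4 (λ s q u i → (s :* u :- q) :* i :+ s :* con (+ 1) := s :- q :* i :+ s :* (u :* i))
          refl side q (1# - q) ((1# - q) ⁻¹)))
      (0<x*y 0<side*[1-q]-q (0<x⁻¹ 0<1-q))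

    D : Fin size → ℝ²
    D i = V⁺ i -ᴹ V i

    side≤∥D∥ : ∀ i → side ≤ ∥ D i ∥
    side≤∥D∥ i = ≤-respʳ-≈ (dist-comm (V i) (V⁺ i)) (proj₁ isSmallest i)

    0<∥D∥-ρ : ∀ i → 0# < ∥ D i ∥ - ρ
    0<∥D∥-ρ i = <-≤-trans 0<side-ρ (+-mono-≤ (side≤∥D∥ i) ≤-refl)

    0<∥D∥ : ∀ i → 0# < ∥ D i ∥
    0<∥D∥ i = <-≤-trans (0<∥D∥-ρ i) (≤-from 0≤ρ (solve 2 (λ l r → l := l :- r :+ r) refl _ _))

    -- As multiples of D i, a unit vector has length ℓ i, and a tail of total length ρ,
    -- which is q + q² + ⋯, has length κ i.
    ℓ κ δ : Fin size → ℝ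
    ℓ i = ∥ D i ∥ ⁻¹
    κ i = ρ * ℓ i
    δ i = 1# - κ i

    0≤ℓ : ∀ i → 0# ≤ ℓ i
    0≤ℓ i = proj₁ (0<x⁻¹ (0<∥D∥ i))

    0≤κ : ∀ i → 0# ≤ κ i
    0≤κ i = *-nonNeg 0≤ρ (0≤ℓ i)

    -- The room to spare: `ρ` is less than `side`, hence less than every `∥ D i ∥`.
    0<δ : ∀ i → 0# < δ i
    0<δ i = <-respʳ-≈
      (≈-from 1# (*-inverseʳ (>⇒≉0 (0<∥D∥ i)))
        (solve 3 (λ l r i → (l :- r) :* i :+ con (+ 1) :* con (+ 1) := con (+ 1) :- r :* i :+ con (+ 1) :* (l :* i))
          refl (∥ D i ∥) ρ (ℓ i)))
      (0<x*y (0<∥D∥-ρ i) (0<x⁻¹ (0<∥D∥ i)))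

    κ≤1 : ∀ i → κ i ≤ 1#
    κ≤1 i = ≤-from (proj₁ (0<δ i)) (solve 1 (λ k → con (+ 1) := k :+ (con (+ 1) :- k)) refl (κ i))

    abstract
      -- The vector is the unit vector against the direction of side `i`. The side it lies on is
      -- where a term preceding a tail along side `i` is to be sought.
      turn : ∀ i → Σ[ j ∈ Fin size ] ∃[ t ] (t ∈[0, 1# ] × -ᴹ (ℓ i *ₗ D i) ≈ᴹ segment (V j) (V⁺ j) t)
      turn i = unit-on-side _ (trans (∥-x∥≈∥x∥ (ℓ i *ₗ D i)) (trans (∥a*x∥≈a*∥x∥ (0≤ℓ i) (D i))
        (trans (*-comm _ _) (*-inverseʳ (>⇒≉0 (0<∥D∥ i))))))

    τ : Fin size → Fin size
    τ i = proj₁ (turn i)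

    θ : Fin size → ℝ
    θ i = proj₁ (proj₂ (turn i))

    θ∈[0,1] : ∀ i → θ i ∈[0, 1# ]
    θ∈[0,1] i = proj₁ (proj₂ (proj₂ (turn i)))

    -ℓD≈ : ∀ i → -ᴹ (ℓ i *ₗ D i) ≈ᴹ segment (V (τ i)) (V⁺ (τ i)) (θ i)
    -ℓD≈ i = proj₂ (proj₂ (proj₂ (turn i)))

    Uniform : ℕ → Set
    Uniform n = Σ[ i ∈ Fin size ] Σ[ x ∈ ℝ² ] Σ[ γ ∈ Fin 2 ]
      (∀ t → t ∈[0, 1# ] → colour (x +ᴹ q ^ n *ₗ segment (V i) (V⁺ i) t) ≡ γ)

    search : ∀ n i x γ →
      (∃[ t ] (t ∈[0, 1# ] × colour (x +ᴹ q ^ n *ₗ segment (V i) (V⁺ i) t) ≡ γ)) ⊎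
      (∀ t → t ∈[0, 1# ] → colour (x +ᴹ q ^ n *ₗ segment (V i) (V⁺ i) t) ≡ opposite γ)
    search n i x γ with em {P = ∃[ t ] (t ∈[0, 1# ] × colour (x +ᴹ q ^ n *ₗ segment (V i) (V⁺ i) t) ≡ γ)}
    ... | yes found = inj₁ found
    ... | no  none  = inj₂ λ t t∈ → ≢⇒≡opposite λ eq → none (t , t∈ , eq)

    -- Consequences of the absence of a monochromatic sequence.

    module NoSequence (none : ¬ MonochromaticSequence c) where

      -- Otherwise both colours occur in every candidate set, and a walk from `0ᴹ` in the colour of
      -- `0ᴹ`, with its `n`-th step in `q ^ n` times side `zero`, never gets stuck. Chains record
      -- steps backwards, hence the negated side.
      uniform-exists : ∃ Uniform
      uniform-exists with em {P = ∃ Uniform}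
      ... | yes found = found
      ... | no  never = contradiction
              (chain⇒sequence c 0<q (additive-neg (additive-side zero)) (proj₁ ∘ state , proj₂ ∘ state , back)) none
        where
        γ : Fin 2
        γ = colour 0ᴹ
        forward : ∀ n x → ∃[ t ] (t ∈[0, 1# ] × colour (x +ᴹ q ^ n *ₗ segment (V zero) (V⁺ zero) t) ≡ γ)
        forward n x with search n zero x γ
        ... | inj₁ found   = found
        ... | inj₂ uniform = contradiction (n , zero , x , opposite γ , uniform) never
        state : ℕ → Σ[ x ∈ ℝ² ] colour x ≡ γ
        state zero    = 0ᴹ , ≡.refl
        state (suc n) with forward n (proj₁ (state n))
        ... | t , _ , colour≡ = (proj₁ (state n) +ᴹ q ^ n *ₗ segment (V zero) (V⁺ zero) t) , colour≡
        back : ∀ n → ∃[ t ] (t ∈[0, 1# ] ×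
               proj₁ (state n) ≈ᴹ proj₁ (state (suc n)) +ᴹ q ^ n *ₗ segment (-ᴹ V zero) (-ᴹ V⁺ zero) t)
        back n with forward n (proj₁ (state n))
        ... | t , t∈ , _ = t , t∈ , (e _ _ _ _ _ , e _ _ _ _ _)
          where
          e : ∀ x Q a b t → x ≈ x + Q * (a + t * (b - a)) + Q * (- a + t * (- b - - a))
          e = solve 5 (λ x Q a b t → x := x :+ Q :* (a :+ t :* (b :- a)) :+ Q :* (:- a :+ t :* (:- b :- :- a))) refl

      -- Descent on `n`: a chain that cannot be extended by one earlier term in its colour exhibits
      -- a uniform translate of a smaller level, and a chain that reaches index 0 is a forbidden
      -- sequence.
      no-chain : ∀ n → (∀ {m} → m ℕ.< n → ¬ Uniform m) → ∀ {i γ} → ¬ Chain c n (V i) (V⁺ i) γ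
      no-chain zero    minimal {i} chain = none (chain⇒sequence c 0<q (additive-side i) chain)
      no-chain (suc n) minimal {i} {γ} chain with search n i (proj₁ chain 0) γ
      ... | inj₁ (t , t∈ , eq) = no-chain n (λ m<n → minimal (ℕ.m<n⇒m<1+n m<n)) (prepend c n chain t∈ eq)
      ... | inj₂ uniform       = minimal (ℕ.n<1+n n) (i , proj₁ chain 0 , opposite γ , uniform)

      -- The least uniform level: growing strips.

      module FirstUniformLevel (n : ℕ) (minimal : ∀ {m} → m ℕ.< n → ¬ Uniform m) where

        Q : ℝ
        Q = q ^ n

        -- The positions `s m` start at 0 and stay below `κ i`. Consecutive ones differ by
        -- `(1# - q) * q ^ m * κ i`, which is `q ^ suc m * ℓ i`, so after scaling by `Q` the step
        -- has norm `q ^ (suc n ℕ.+ m)`. Read backwards it has the direction that `turn` places on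
        -- side `τ i`.
        tail-chain : ∀ {x γ} i → (∀ t → t ∈[0, κ i ] → colour (x +ᴹ Q *ₗ (t *ₗ D i)) ≡ γ) →
                     Σ[ chain ∈ Chain c (suc n) (V (τ i)) (V⁺ (τ i)) γ ] x ≈ᴹ proj₁ chain 0
        tail-chain {x} {γ} i mono =
          (p , (λ m → mono (s m) (s∈ m)) , λ m → θ i , θ∈[0,1] i ,
            (step m _ (proj₁ (D i)) (proj₁ (-ℓD≈ i)) , step m _ (proj₂ (D i)) (proj₂ (-ℓD≈ i)))) ,
          (start _ _ , start _ _)
          where
          s : ℕ → ℝ
          s m = (1# - q ^ m) * κ i
          s∈ : ∀ m → s m ∈[0, κ i ]
          s∈ m = *-nonNeg (0≤y-x (x^n≤1 (proj₁ 0<q) q≤1 m)) (0≤κ i) ,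
                 ≤-from (*-nonNeg (proj₁ (0<x^n 0<q m)) (0≤κ i))
                   (solve 2 (λ y k → k := (con (+ 1) :- y) :* k :+ y :* k) refl (q ^ m) (κ i))
          p : ℕ → ℝ²
          p m = x +ᴹ Q *ₗ (s m *ₗ D i)
          start : ∀ x d → x ≈ x + Q * (s 0 * d)
          start = solve 4 (λ Q k x d → x := x :+ Q :* ((con (+ 1) :- con (+ 1)) :* k :* d)) refl Q (κ i)
          step : ∀ m x d {g} → - (ℓ i * d) ≈ g →
                 x + Q * (s m * d) ≈ x + Q * (s (suc m) * d) + q ^ (suc n ℕ.+ m) * g
          step m x d {g} e = begin
            x + Q * (s m * d)                                     ≈⟨ factor (q ^ m) ⟩
            x + (1# - q ^ m) * (ρ * W)                            ≈⟨ shift ⟩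
            x + (1# - q ^ suc m) * (ρ * W) + - (q * (q ^ m * W))  ≈⟨ +-cong (factor (q ^ suc m)) next-step ⟨
            x + Q * (s (suc m) * d) + q ^ (suc n ℕ.+ m) * g       ∎
            where
            open import Algebra.Properties.Semiring.Exp semiring using (^-homo-*)
            open import Relation.Binary.Reasoning.Setoid ℝ-setoid
            W = Q * (ℓ i * d)
            factor : ∀ y → x + Q * ((1# - y) * κ i * d) ≈ x + (1# - y) * (ρ * W)
            factor y = +-congˡ (solve 5 (λ Q u r l d → Q :* (u :* (r :* l) :* d) := u :* (r :* (Q :* (l :* d))))
              refl Q (1# - y) ρ (ℓ i) d)
            shift : x + (1# - q ^ m) * (ρ * W) ≈ x + (1# - q ^ suc m) * (ρ * W) + - (q * (q ^ m * W))
            shift = ≈-from (- (q ^ m * W)) ρ*[1-q]≈q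
              (solve 5 (λ x y q r w →
                x :+ (con (+ 1) :- y) :* (r :* w) :+ :- (y :* w) :* q :=
                x :+ (con (+ 1) :- q :* y) :* (r :* w) :+ :- (q :* (y :* w)) :+ :- (y :* w) :* (r :* (con (+ 1) :- q)))
                refl x (q ^ m) q ρ W)
            next-step : q ^ (suc n ℕ.+ m) * g ≈ - (q * (q ^ m * W))
            next-step = trans (*-cong (*-congˡ (^-homo-* q n m)) (sym e))
              (solve 4 (λ q Q y w → q :* (Q :* y) :* :- w := :- (q :* (y :* (Q :* w)))) refl q Q (q ^ m) (ℓ i * d))

        -- A monochromatic tail can only be blocked by an oppositely coloured translate
        -- of the side containing the backward direction of the tail.
        blocked : ∀ {x γ} i → (∀ t → t ∈[0, κ i ] → colour (x +ᴹ Q *ₗ (t *ₗ D i)) ≡ γ) →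
                  ∀ t → t ∈[0, 1# ] → colour (x +ᴹ Q *ₗ segment (V (τ i)) (V⁺ (τ i)) t) ≡ opposite γ
        blocked {x} {γ} i mono = resolve (search n (τ i) x γ) (tail-chain i mono)
          where
          Target : Fin 2 → ℝ → Set
          Target γ′ t = colour (x +ᴹ Q *ₗ segment (V (τ i)) (V⁺ (τ i)) t) ≡ γ′
          resolve : (∃[ t ] (t ∈[0, 1# ] × Target γ t)) ⊎ (∀ t → t ∈[0, 1# ] → Target (opposite γ) t) →
                    Σ[ chain ∈ Chain c (suc n) (V (τ i)) (V⁺ (τ i)) γ ] x ≈ᴹ proj₁ chain 0 →
                    ∀ t → t ∈[0, 1# ] → Target (opposite γ) t
          resolve (inj₂ uniform)       _                  = uniform
          resolve (inj₁ (t , t∈ , eq)) (chain , e₁ , e₂) = contradiction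
            (prepend c n chain t∈ (≡.trans (colour-cong (+-congʳ (sym e₁) , +-congʳ (sym e₂))) eq))
            (no-chain n minimal)

        -- A monochromatic parallelogram, swept by a translate of `Q` times side `j` moving along
        -- side `i`; `K` is the extent of the motion in units of `Q *ₗ D i`.
        Strip : Fin size → ℝ → Fin size → Set
        Strip i K j = Σ[ x ∈ ℝ² ] Σ[ γ ∈ Fin 2 ] (∀ s t → s ∈[0, K ] → t ∈[0, 1# ] →
          colour (x +ᴹ Q *ₗ (s *ₗ D i +ᴹ segment (V j) (V⁺ j) t)) ≡ γ)

        -- Extent zero suits every direction of motion, which leaves `i` free until a recurrent side
        -- is known.
        strip-start : Uniform n → Σ[ j ∈ Fin size ] (∀ i → Strip i 0# j)
        strip-start (j , x , γ , uniform) = j , λ i → x , γ , λ s t (0≤s , s≤0) t∈ →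
          ≡.trans (colour-cong (e (≤-antisym s≤0 0≤s) _ _ _ , e (≤-antisym s≤0 0≤s) _ _ _)) (uniform t t∈)
          where
          e : ∀ {s} → s ≈ 0# → ∀ x d v → x + Q * (s * d + v) ≈ x + Q * v
          e {s} s≈0 x d v = ≈-from (Q * d) s≈0
            (solve 5 (λ Q s x d v → x :+ Q :* (s :* d :+ v) :+ Q :* d :* con (+ 0) := x :+ Q :* v :+ Q :* d :* s) refl Q s x d v)

        regroup : ∀ s x v d w → x + Q * v + Q * (s * d + w) ≈ x + Q * (s * d + v) + Q * w
        regroup = solve 6 (λ Q s x v d w → x :+ Q :* v :+ Q :* (s :* d :+ w) :=
                    x :+ Q :* (s :* d :+ v) :+ Q :* w) refl Q

        -- For each `s` the translate of side `j` is long enough for a tail starting at its end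
        -- `V j`, as `κ j` is at most 1. The blocked translates of side `τ j` move with `s` and form
        -- the new strip.
        strip-turn : ∀ {i K j} → Strip i K j → Strip i K (τ j)
        strip-turn {i} {K} {j} (x , γ , mono) = x +ᴹ Q *ₗ V j , opposite γ , λ s t s∈ t∈ →
          ≡.trans (colour-cong (regroup s _ _ _ _ , regroup s _ _ _ _))
            (blocked {x +ᴹ Q *ₗ (s *ₗ D i +ᴹ V j)} j
              (λ u (0≤u , u≤κ) → ≡.trans (colour-cong (merge s u _ _ _ _ , merge s u _ _ _ _))
                (mono s u s∈ (0≤u , ≤-trans u≤κ (κ≤1 j)))) t t∈)
          where
          merge : ∀ s u x d v v⁺ → x + Q * (s * d + v) + Q * (u * (v⁺ - v)) ≈ x + Q * (s * d + (v + u * (v⁺ - v)))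
          merge = solve 7 (λ Q s u x d v v⁺ → x :+ Q :* (s :* d :+ v) :+ Q :* (u :* (v⁺ :- v)) :=
                    x :+ Q :* (s :* d :+ (v :+ u :* (v⁺ :- v)))) refl Q

        -- When i = j the strip is a segment of length K + 1 (in units of Q D i), so tails of
        -- length κ i can start at any s ≤ K + δ i.
        strip-grow : ∀ {i K} → 0# ≤ K → Strip i K i → Strip i (K + δ i) (τ i)
        strip-grow {i} {K} 0≤K (x , γ , mono) = x +ᴹ Q *ₗ V i , opposite γ , λ s t s∈ t∈ →
          ≡.trans (colour-cong (regroup s _ _ _ _ , regroup s _ _ _ _))
            (blocked {x +ᴹ Q *ₗ (s *ₗ D i +ᴹ V i)} i (tail s s∈) t t∈)
          where
          merge : ∀ s u r x v v⁺ → x + Q * ((s + r) * (v⁺ - v) + v) + Q * (u * (v⁺ - v)) ≈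
                                   x + Q * (s * (v⁺ - v) + (v + (r + u) * (v⁺ - v)))
          merge = solve 7 (λ Q s u r x v v⁺ → x :+ Q :* ((s :+ r) :* (v⁺ :- v) :+ v) :+ Q :* (u :* (v⁺ :- v)) :=
                    x :+ Q :* (s :* (v⁺ :- v) :+ (v :+ (r :+ u) :* (v⁺ :- v)))) refl Q
          -- The starting point is reached by a motion `s₀` of the side and an offset `r` within it;
          -- an offset of at most `δ i` leaves `κ i` for the tail.
          split : ∀ {s} → s ∈[0, K + δ i ] → ∃[ s₀ ] ∃[ r ] (s₀ ∈[0, K ] × r ∈[0, δ i ] × s ≈ s₀ + r)
          split {s} (0≤s , s≤K+δ) with ≤-total s K
          ... | inj₁ s≤K = s , 0# , (0≤s , s≤K) , 0∈[0, proj₁ (0<δ i) ] , sym (+-identityʳ s)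
          ... | inj₂ K≤s = K , s - K , (0≤K , ≤-refl) ,
                  (0≤y-x K≤s , ≤-from (0≤y-x s≤K+δ)
                    (solve 3 (λ s k d → d := s :- k :+ (k :+ d :- s)) refl s K (δ i))) ,
                  solve 2 (λ s k → s := k :+ (s :- k)) refl s K
          tail : ∀ s → s ∈[0, K + δ i ] → ∀ u → u ∈[0, κ i ] →
                 colour (x +ᴹ Q *ₗ (s *ₗ D i +ᴹ V i) +ᴹ Q *ₗ (u *ₗ D i)) ≡ γ
          tail s s∈ u (0≤u , u≤κ) with split s∈
          ... | s₀ , r , s₀∈ , (0≤r , r≤δ) , s≈ = ≡.trans
            (colour-cong (trans (adjust _ _ _) (merge s₀ u r _ _ _) , trans (adjust _ _ _) (merge s₀ u r _ _ _)))
            (mono s₀ (r + u) s₀∈ (0≤x+y 0≤r 0≤u ,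
              ≤-respʳ-≈ (solve 1 (λ k → con (+ 1) :- k :+ k := con (+ 1)) refl (κ i)) (+-mono-≤ r≤δ u≤κ)))
            where
            adjust : ∀ x d v {w} → x + Q * (s * d + v) + w ≈ x + Q * ((s₀ + r) * d + v) + w
            adjust x d v = +-congʳ (+-congˡ (*-congˡ (+-congʳ (*-congʳ s≈))))

        strip-iterate : ∀ {i K j} m → Strip i K j → Strip i K (fold j τ m)
        strip-iterate zero    strip = strip
        strip-iterate (suc m) strip = strip-turn (strip-iterate m strip)

        -- Otherwise the strip contains both a tail and the point preceding it at distance Q.
        strip-bound : ∀ {i K} → Strip i K i → K ≤ ℓ i
        strip-bound {i} {K} (x , γ , mono) with ≤-total K (ℓ i)
        ... | inj₁ K≤ℓ = K≤ℓ
        -- The tail starts at `ℓ i`; the parameter `θ i` leads back by exactly `ℓ i`, to the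
        -- beginning of the strip. That point has colour `γ` as part of the strip and `opposite γ`
        -- by `blocked`.
        ... | inj₂ ℓ≤K = contradiction
          (≡.trans (≡.sym start)
            (≡.trans (colour-cong (back _ _ _ (proj₁ (-ℓD≈ i)) , back _ _ _ (proj₂ (-ℓD≈ i))))
              (blocked {x +ᴹ Q *ₗ (ℓ i *ₗ D i +ᴹ V i)} i tail (θ i) (θ∈[0,1] i))))
          (opposite≢ γ)
          where
          tail : ∀ u → u ∈[0, κ i ] → colour (x +ᴹ Q *ₗ (ℓ i *ₗ D i +ᴹ V i) +ᴹ Q *ₗ (u *ₗ D i)) ≡ γ
          tail u (0≤u , u≤κ) = ≡.trans (colour-cong (merge _ _ _ , merge _ _ _))
            (mono (ℓ i) u (0≤ℓ i , ℓ≤K) (0≤u , ≤-trans u≤κ (κ≤1 i)))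
            where
            merge : ∀ x v v⁺ → x + Q * (ℓ i * (v⁺ - v) + v) + Q * (u * (v⁺ - v)) ≈
                               x + Q * (ℓ i * (v⁺ - v) + (v + u * (v⁺ - v)))
            merge = solve 6 (λ Q l u x v v⁺ → x :+ Q :* (l :* (v⁺ :- v) :+ v) :+ Q :* (u :* (v⁺ :- v)) :=
                      x :+ Q :* (l :* (v⁺ :- v) :+ (v :+ u :* (v⁺ :- v)))) refl Q (ℓ i) u
          start : colour (x +ᴹ Q *ₗ V i) ≡ γ
          start = ≡.trans (colour-cong (e _ _ _ , e _ _ _))
            (mono 0# 0# 0∈[0, ≤-trans (0≤ℓ i) ℓ≤K ] 0∈[0, 0≤1 ])
            where
            e : ∀ x v d → x + Q * v ≈ x + Q * (0# * d + (v + 0# * d))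
            e = solve 4 (λ Q x v d → x :+ Q :* v := x :+ Q :* (con (+ 0) :* d :+ (v :+ con (+ 0) :* d))) refl Q
          back : ∀ x v d {g} → - (ℓ i * d) ≈ g → x + Q * v ≈ x + Q * (ℓ i * d + v) + Q * g
          back x v d e = trans
            (solve 5 (λ Q l x v d → x :+ Q :* v := x :+ Q :* (l :* d :+ v) :+ Q :* :- (l :* d)) refl Q (ℓ i) x v d)
            (+-congˡ (*-congˡ e))

        -- Two of the first `suc size` iterates agree. The first turn of the cycle is split off
        -- because `strip-grow` performs it; the other `r` turns preserve the extent.
        recurrent : ∀ j → ∃[ m ] ∃[ r ] fold (τ (fold j τ m)) τ r ≡ fold j τ m
        recurrent j with Fin.pigeonhole (ℕ.n<1+n size) (λ m → fold j τ (toℕ m))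
        ... | a , b , a<b , eq = toℕ a , toℕ b ℕ.∸ suc (toℕ a) , ≡.trans
          (≡.sym (fold-+ j τ (toℕ b ℕ.∸ suc (toℕ a))))
          (≡.trans (≡.cong (fold j τ) (ℕ.m∸n+n≡m a<b)) (≡.sym eq))

        -- Each round of the cycle lengthens the strip by `δ i`, while `ℓ i` bounds all lengths.
        -- Instead of counting rounds, the supremum `σ` is used: `σ - δ i` would be a smaller upper
        -- bound.
        strip-unbounded : ∀ {i} r → fold (τ i) τ r ≡ i → ¬ Strip i 0# i
        strip-unbounded {i} r returns strip =
          <⇒≱ (0<δ i) (≤-from (0≤y-x σ≤σ-δ) (solve 2 (λ s d → con (+ 0) := d :+ (s :- d :- s)) refl σ (δ i)))
          where
          Length : ℝ → Set
          Length K = 0# ≤ K × Strip i K i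
          sup : ∃[ σ ] (IsUpperBound Length σ × (∀ b → IsUpperBound Length b → σ ≤ b))
          sup = supremum Length (0# , ≤-refl , strip) (ℓ i , λ K (_ , strip) → strip-bound strip)
          σ : ℝ
          σ = proj₁ sup
          grow : ∀ {K} → Length K → Length (K + δ i)
          grow {K} (0≤K , strip) = 0≤x+y 0≤K (proj₁ (0<δ i)) ,
            ≡.subst (Strip i (K + δ i)) returns (strip-iterate r (strip-grow 0≤K strip))
          σ≤σ-δ : σ ≤ σ - δ i
          σ≤σ-δ = proj₂ (proj₂ sup) (σ - δ i) λ K K∈ → ≤-from
            (0≤y-x (proj₁ (proj₂ sup) (K + δ i) (grow K∈)))
            (solve 3 (λ s d k → s :- d := k :+ (s :- (k :+ d))) refl σ (δ i) K)

        not-uniform : ¬ Uniform n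
        not-uniform uniform =
          let j , strip     = strip-start uniform
              m , r , returns = recurrent j
          in strip-unbounded r returns (strip-iterate m (strip (fold j τ m)))

      absurd : ⊥
      absurd = never (proj₁ uniform-exists) (proj₂ uniform-exists)
        where
        never : ∀ n → ¬ Uniform n
        never = <-rec (λ n → ¬ Uniform n) λ n minimal → FirstUniformLevel.not-uniform n minimal

    monochromatic-sequence : MonochromaticSequence c
    monochromatic-sequence with em {P = MonochromaticSequence c}
    ... | yes sequence = sequence
    ... | no  none     = ⊥-elim (NoSequence.absurd none)

-- The bound on the chromatic number.

theorem2 : ExcludedMiddle 0ℓ → (R : CompleteOrderedField) → let open Plane R in
    (N : Norm) (polygonal : Polygonal N)
    (side : ℝ) → Polygonal.IsSmallestSideLength polygonal side →
    (q : ℝ) → 0# < q → q < side / (1# + side) →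
    (χ[ N , 𝒢 q ]≥ 3) × ((c : Colouring 2) → HasMonochromaticCopy N (𝒢 q) c)
theorem2 em R N polygonal side isSmallest q 0<q q< =
  (λ k (c , no-copy) → ℕ.≮⇒≥ λ k<3 → no-copy (sequence⇒copy c (restrict (ℕ.s≤s⁻¹ k<3) c))) ,
  (λ c → sequence⇒copy c (sequence c))
  where
  open Plane R using (Colouring)
  open Progressions R N q
  sequence : (c : Colouring 2) → MonochromaticSequence c
  sequence = Ramsey.TwoColouring.monochromatic-sequence em R N polygonal side isSmallest q 0<q q<
  -- Fewer colours embed into two, and injectivity of the embedding pulls the common colour back to
  -- that of `p 0`.
  restrict : ∀ {k} → k ℕ.≤ 2 → (c : Colouring k) → MonochromaticSequence c
  restrict k≤2 c with sequence (record
    { to = λ x → inject≤ (Func.to c x) k≤2 ; cong = λ x≈y → ≡.cong (λ i → inject≤ i k≤2) (Func.cong c x≈y) })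
  ... | p , γ , mono , isometric = p , Func.to c (p 0) ,
    (λ m → Fin.inject≤-injective k≤2 k≤2 _ _ (≡.trans (mono m) (≡.sym (mono 0)))) , isometric
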